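{- Let $\mathbb{K}$ be a commutative ring with unit and let $(M,M')$ be a matroid perspective on a finite ground set $E$. The Las Vergnas polynomial satisfies the following convolution formula in the polynomial algebra $\mathbb{K}[a,b,c,d,e,f]$: $$\mathfrak{T}_{M,M'}(1-ab,1-cd,-ef)=\sum_{A\subseteq E}a^{\mathrm{rk}(M')-\mathrm{rk}_{M'}(A)}\,d^{|A|-\mathrm{rk}_M(A)}\,e^{(\mathrm{rk}(M)-\mathrm{rk}_M(A))-(\mathrm{rk}(M')-\mathrm{rk}_{M'}(A))}\;\mathfrak{T}_{M|A,M'|A}(1-a,1-c,-e)\;\mathfrak{T}_{M/A,M'/A}(1-b,1-d,-f).$$
   Context: A matroid perspective is a pair $(M,M')$ of matroids on the same finite ground set $E$ such that for all $A\subseteq B\subseteq E$, $\mathrm{rk}_M(B)-\mathrm{rk}_M(A)\ge \mathrm{rk}_{M'}(B)-\mathrm{rk}_{M'}(A)$. Here $\mathrm{rk}_M$ is the rank function of $M$, and $\mathrm{rk}(M)=\mathrm{rk}_M(E)$. Restriction $(M|A,M'|A)$ and contraction $(M/A,M'/A)$ are taken componentwise and are again matroid perspectives. The Las Vergnas polynomial of $(M,M')$ is $$\mathfrak{T}_{M,M'}(x,y,z)=\sum_{A\subseteq E}(x-1)^{\mathrm{rk}(M')-\mathrm{rk}_{M'}(A)}(y-1)^{|A|-\mathrm{rk}_M(A)}z^{(\mathrm{rk}(M)-\mathrm{rk}_M(A))-(\mathrm{rk}(M')-\mathrm{rk}_{M'}(A))}.$$ -}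

module Defs where

open import Algebra.Bundles using (CommutativeRing)
import Algebra.Properties.CommutativeSemigroup as CommutativeSemigroupProperties
import Algebra.Properties.Ring as RingProperties
import Algebra.Properties.Semiring.Exp as Exp
open import Data.Bool.Base using (if_then_else_; true; false)
open import Data.Fin.Base using (Fin)
open import Data.Fin.Subset
  using (Subset; inside; outside; _⊆_; _∪_; _∩_; _─_; ∣_∣)
import Data.Fin.Subset.Properties as Subset
open import Data.List.Base as List using (List; []; _∷_; _++_)
open import Data.Nat.Base using (ℕ; _≤_; _∸_)
import Data.Nat.Base as ℕ
import Data.Nat.Properties as ℕ
open import Data.Product.Base using (_×_; _,_)
open import Data.Sum.Base using (inj₁; inj₂)
open import Data.Vec.Base as Vec using (Vec; []; _∷_)
import Data.Vec.Properties as Vec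
open import Function.Base using (_∘_; id)
open import Level using (Level)
open import Relation.Binary.Definitions using (DecidableEquality)
open import Relation.Binary.PropositionalEquality as ≡
  using (_≡_; cong; cong₂)
open import Relation.Nullary using (yes; no; does; ¬_; contradiction)

private variable
  k ℓ : Level
  n : ℕ

-- Every finite ground set is represented as a subset E of some Fin n, so that
-- a minor of a matroid on E again lives on a subset of the same Fin n.  The
-- values of `rk` on subsets of Fin n not contained in E carry no meaning.
record Matroid {n : ℕ} (E : Subset n) : Set where
  field
    rk            : Subset n → ℕ
    rk-bounded    : ∀ {A} → A ⊆ E → rk A ≤ ∣ A ∣
    rk-monotone   : ∀ {A B} → A ⊆ B → B ⊆ E → rk A ≤ rk B
    rk-submodular : ∀ {A B} → A ⊆ E → B ⊆ E →
                    rk (A ∪ B) ℕ.+ rk (A ∩ B) ≤ rk A ℕ.+ rk B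

  rank : ℕ
  rank = rk E

private
  ∪-lub : ∀ {A B C : Subset n} → A ⊆ C → B ⊆ C → A ∪ B ⊆ C
  ∪-lub {A = A} {B} A⊆C B⊆C x∈ with Subset.x∈p∪q⁻ A B x∈
  ... | inj₁ x∈A = A⊆C x∈A
  ... | inj₂ x∈B = B⊆C x∈B

  ∪-monoˡ : ∀ {A B} (C : Subset n) → A ⊆ B → A ∪ C ⊆ B ∪ C
  ∪-monoˡ {B = B} C A⊆B =
    ∪-lub (Subset.p⊆p∪q C ∘ A⊆B) (Subset.q⊆p∪q B C)

  ─-∪-⊆ : ∀ {A B E : Subset n} → A ⊆ E → B ⊆ E ─ A → B ∪ A ⊆ E
  ─-∪-⊆ {A = A} {E = E} A⊆E B⊆ = ∪-lub (Subset.p─q⊆p E A ∘ B⊆) A⊆E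

  ∪-∪-distrib : ∀ (A B C : Subset n) → (A ∪ B) ∪ C ≡ (A ∪ C) ∪ (B ∪ C)
  ∪-∪-distrib [] [] [] = ≡.refl
  ∪-∪-distrib (a ∷ A) (b ∷ B) (c ∷ C) = cong₂ _∷_ (bit a b c) (∪-∪-distrib A B C)
    where
    open import Data.Bool.Base using (_∨_)
    bit : ∀ a b c → (a ∨ b) ∨ c ≡ (a ∨ c) ∨ (b ∨ c)
    bit true  b     c     = ≡.refl
    bit false true  true  = ≡.refl
    bit false true  false = ≡.refl
    bit false false true  = ≡.refl
    bit false false false = ≡.refl

  ∸-submodular : ∀ {u i a b m} → m ≤ u → m ≤ i → m ≤ a → m ≤ b →
                 u ℕ.+ i ≤ a ℕ.+ b →
                 (u ∸ m) ℕ.+ (i ∸ m) ≤ (a ∸ m) ℕ.+ (b ∸ m)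
  ∸-submodular {m = m} m≤u m≤i m≤a m≤b le
    with ℕ.m≤n⇒∃[o]m+o≡n m≤u | ℕ.m≤n⇒∃[o]m+o≡n m≤i
       | ℕ.m≤n⇒∃[o]m+o≡n m≤a | ℕ.m≤n⇒∃[o]m+o≡n m≤b
  ... | u , ≡.refl | i , ≡.refl | a , ≡.refl | b , ≡.refl
    rewrite ℕ.m+n∸m≡n m u | ℕ.m+n∸m≡n m i | ℕ.m+n∸m≡n m a | ℕ.m+n∸m≡n m b =
    ℕ.+-cancelˡ-≤ (m ℕ.+ m) _ _
      (≡.subst₂ _≤_ (interchange m u m i) (interchange m a m b) le)
    where open CommutativeSemigroupProperties ℕ.+-commutativeSemigroup

  ∸-∸-cancel : ∀ {a b m} → m ≤ a → a ≤ b → (b ∸ m) ∸ (a ∸ m) ≡ b ∸ a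
  ∸-∸-cancel {a} {b} {m} m≤a a≤b =
    ≡.trans (ℕ.∸-+-assoc b m (a ∸ m)) (cong (b ∸_) (ℕ.m+[n∸m]≡n m≤a))

restrict : ∀ {n} {E : Subset n} → Matroid E → (A : Subset n) → A ⊆ E → Matroid A
restrict M A A⊆E = record
  { rk            = rk
  ; rk-bounded    = λ B⊆A → rk-bounded (A⊆E ∘ B⊆A)
  ; rk-monotone   = λ B⊆C C⊆A → rk-monotone B⊆C (A⊆E ∘ C⊆A)
  ; rk-submodular = λ B⊆A C⊆A → rk-submodular (A⊆E ∘ B⊆A) (A⊆E ∘ C⊆A)
  }
  where open Matroid M

contract : ∀ {n} {E : Subset n} → Matroid E → (A : Subset n) → A ⊆ E → Matroid (E ─ A)
contract {n} {E} M A A⊆E = record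
  { rk            = λ B → rk (B ∪ A) ∸ rk A
  ; rk-bounded    = λ {B} B⊆ → ℕ.m≤n+o⇒m∸n≤o _ (rk A) (bounded B⊆)
  ; rk-monotone   = λ B⊆C C⊆ →
      ℕ.∸-monoˡ-≤ (rk A) (rk-monotone (∪-monoˡ A B⊆C) (─-∪-⊆ A⊆E C⊆))
  ; rk-submodular = submodular
  }
  where
  open Matroid M
  open ℕ.≤-Reasoning

  ground : ∀ {B} → B ⊆ E ─ A → B ⊆ E
  ground B⊆ = Subset.p─q⊆p E A ∘ B⊆

  bounded : ∀ {B} → B ⊆ E ─ A → rk (B ∪ A) ≤ rk A ℕ.+ ∣ B ∣
  bounded {B} B⊆ = begin
    rk (B ∪ A)                    ≤⟨ ℕ.m≤m+n _ _ ⟩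
    rk (B ∪ A) ℕ.+ rk (B ∩ A)     ≤⟨ rk-submodular (ground B⊆) A⊆E ⟩
    rk B ℕ.+ rk A                 ≡⟨ ℕ.+-comm (rk B) (rk A) ⟩
    rk A ℕ.+ rk B                 ≤⟨ ℕ.+-monoʳ-≤ (rk A) (rk-bounded (ground B⊆)) ⟩
    rk A ℕ.+ ∣ B ∣                ∎

  above : ∀ {B} → B ⊆ E ─ A → rk A ≤ rk (B ∪ A)
  above {B} B⊆ = rk-monotone (Subset.q⊆p∪q B A) (─-∪-⊆ A⊆E B⊆)

  submodular : ∀ {B C} → B ⊆ E ─ A → C ⊆ E ─ A →
    (rk ((B ∪ C) ∪ A) ∸ rk A) ℕ.+ (rk ((B ∩ C) ∪ A) ∸ rk A) ≤
    (rk (B ∪ A) ∸ rk A) ℕ.+ (rk (C ∪ A) ∸ rk A)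
  submodular {B} {C} B⊆ C⊆ =
    ∸-submodular (above (∪-lub B⊆ C⊆)) (above (B⊆ ∘ Subset.p∩q⊆p B C))
      (above B⊆) (above C⊆)
      (≡.subst₂ (λ X Y → rk X ℕ.+ rk Y ≤ rk (B ∪ A) ℕ.+ rk (C ∪ A))
        (≡.sym (∪-∪-distrib B C A)) (≡.sym (Subset.∪-distribʳ-∩ A B C))
        (rk-submodular (─-∪-⊆ A⊆E B⊆) (─-∪-⊆ A⊆E C⊆)))

-- The subtractions are truncated, but they never actually truncate since
-- rank functions are monotone.
record MatroidPerspective {n : ℕ} (E : Subset n) : Set where
  field
    M M′ : Matroid E
  open Matroid M public using (rk; rank)
  open Matroid M′ public using () renaming (rk to rk′; rank to rank′)
  field
    perspective : ∀ {A B} → A ⊆ B → B ⊆ E → rk′ B ∸ rk′ A ≤ rk B ∸ rk A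

infixl 8 _∣[_,_] _/[_,_]

_∣[_,_] : ∀ {n} {E : Subset n} → MatroidPerspective E →
          (A : Subset n) → A ⊆ E → MatroidPerspective A
P ∣[ A , A⊆E ] = record
  { M           = restrict M A A⊆E
  ; M′          = restrict M′ A A⊆E
  ; perspective = λ B⊆C C⊆A → perspective B⊆C (A⊆E ∘ C⊆A)
  }
  where open MatroidPerspective P

_/[_,_] : ∀ {n} {E : Subset n} → MatroidPerspective E →
          (A : Subset n) → A ⊆ E → MatroidPerspective (E ─ A)
_/[_,_] {n} {E} P A A⊆E = record
  { M           = contract M A A⊆E
  ; M′          = contract M′ A A⊆E
  ; perspective = λ {B} {C} B⊆C C⊆ →
      ≡.subst₂ _≤_ (≡.sym (difference M′ B⊆C C⊆)) (≡.sym (difference M B⊆C C⊆))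
        (perspective (∪-monoˡ A B⊆C) (─-∪-⊆ A⊆E C⊆))
  }
  where
  open MatroidPerspective P
  difference : ∀ (N : Matroid E) {B C} → B ⊆ C → C ⊆ E ─ A →
    let open Matroid N using () renaming (rk to r) in
    (r (C ∪ A) ∸ r A) ∸ (r (B ∪ A) ∸ r A) ≡ r (C ∪ A) ∸ r (B ∪ A)
  difference N {B} B⊆C C⊆ =
    ∸-∸-cancel (rk-monotone (Subset.q⊆p∪q B A) (─-∪-⊆ A⊆E (C⊆ ∘ B⊆C)))
               (rk-monotone (∪-monoˡ A B⊆C) (─-∪-⊆ A⊆E C⊆))
    where open Matroid N using (rk-monotone)

module LasVergnas (R : CommutativeRing k ℓ) where
  open CommutativeRing R hiding (zero; refl)
  open Exp semiring public using (_^_)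

  -- ∑⊆ E f is the sum of f A over all A ⊆ E, each subset occurring once:
  -- an element outside E is outside every A ⊆ E.
  ∑⊆ : ∀ {n} (E : Subset n) → (∀ A → A ⊆ E → Carrier) → Carrier
  ∑⊆ []            f = f [] id
  ∑⊆ (outside ∷ E) f = ∑⊆ E λ A A⊆E → f (outside ∷ A) (Subset.out⊆ A⊆E)
  ∑⊆ (inside  ∷ E) f =
    ∑⊆ E (λ A A⊆E → f (outside ∷ A) (Subset.out⊆ A⊆E)) +
    ∑⊆ E (λ A A⊆E → f (inside ∷ A) (Subset.in⊆in A⊆E))

  -- The Las Vergnas polynomial evaluated at elements x, y, z of R; the
  -- polynomial itself is the case of the three variables of a polynomial ring.
  -- The perspective condition for A ⊆ E makes every truncated subtraction exact.
  𝔗 : ∀ {n} {E : Subset n} → MatroidPerspective E → (x y z : Carrier) → Carrier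
  𝔗 {E = E} P x y z = ∑⊆ E λ A _ →
    (x - 1#) ^ (rank′ ∸ rk′ A) *
    (y - 1#) ^ (∣ A ∣ ∸ rk A) *
    z ^ ((rank ∸ rk A) ∸ (rank′ ∸ rk′ A))
    where open MatroidPerspective P

-- Polynomials in n variables over a commutative ring, as finite formal sums of
-- terms (coefficient , exponent vector) in which monomials may repeat; two
-- such sums are identified when all their collected coefficients agree.
module Polynomial (K : CommutativeRing k ℓ) (n : ℕ) where
  open CommutativeRing K hiding (zero)
  open import Relation.Binary.Reasoning.Setoid setoid
  open CommutativeSemigroupProperties +-commutativeSemigroup using (interchange)
  private
    module *-Props = CommutativeSemigroupProperties *-commutativeSemigroup
    module K-Props = RingProperties ring

  Monomial : Set
  Monomial = Vec ℕ n

  _≟_ : DecidableEquality Monomial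
  _≟_ = Vec.≡-dec ℕ._≟_

  infixl 6 _⊕_
  _⊕_ : Monomial → Monomial → Monomial
  _⊕_ = Vec.zipWith ℕ._+_

  𝟎 : Monomial
  𝟎 = Vec.replicate n 0

  Poly : Set k
  Poly = List (Carrier × Monomial)

  -- The linear extension to polynomials of a function on monomials.
  ⟦_⟧ : Poly → (Monomial → Carrier) → Carrier
  ⟦ []          ⟧ φ = 0#
  ⟦ (c , v) ∷ p ⟧ φ = c * φ v + ⟦ p ⟧ φ

  δ : Monomial → Monomial → Carrier
  δ m v = if does (v ≟ m) then 1# else 0#

  coeff : Poly → Monomial → Carrier
  coeff p m = ⟦ p ⟧ (δ m)

  infix 4 _≋_
  record _≋_ (p q : Poly) : Set ℓ where
    constructor mk≋
    field coeff-≈ : ∀ m → coeff p m ≈ coeff q m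
  open _≋_ public

  scale : Carrier → Monomial → Poly → Poly
  scale c v = List.map λ (d , w) → c * d , v ⊕ w

  infixl 7 _⊛_
  _⊛_ : Poly → Poly → Poly
  []            ⊛ q = []
  ((c , v) ∷ p) ⊛ q = scale c v q ++ p ⊛ q

  ⊖_ : Poly → Poly
  ⊖_ = List.map λ (c , v) → - c , v

  0ᴾ 1ᴾ : Poly
  0ᴾ = []
  1ᴾ = (1# , 𝟎) ∷ []

  var : Fin n → Poly
  var i = (1# , 𝟎 Vec.[ i ]≔ 1) ∷ []

  private
    ⟦⟧-cong : ∀ p {φ ψ} → (∀ v → φ v ≈ ψ v) → ⟦ p ⟧ φ ≈ ⟦ p ⟧ ψ
    ⟦⟧-cong []            eq = refl
    ⟦⟧-cong ((c , v) ∷ p) eq = +-cong (*-congˡ (eq v)) (⟦⟧-cong p eq)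

    ⟦⟧-++ : ∀ p q φ → ⟦ p ++ q ⟧ φ ≈ ⟦ p ⟧ φ + ⟦ q ⟧ φ
    ⟦⟧-++ []            q φ = sym (+-identityˡ _)
    ⟦⟧-++ ((c , v) ∷ p) q φ =
      trans (+-congˡ (⟦⟧-++ p q φ)) (sym (+-assoc _ _ _))

    ⟦⟧-⊖ : ∀ p φ → ⟦ ⊖ p ⟧ φ ≈ - ⟦ p ⟧ φ
    ⟦⟧-⊖ []            φ = sym K-Props.-0#≈0#
    ⟦⟧-⊖ ((c , v) ∷ p) φ =
      trans (+-cong (sym (K-Props.-‿distribˡ-* c (φ v))) (⟦⟧-⊖ p φ))
            (K-Props.-‿+-comm _ _)

    ⟦⟧-zero : ∀ p → ⟦ p ⟧ (λ _ → 0#) ≈ 0#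
    ⟦⟧-zero []            = refl
    ⟦⟧-zero ((c , v) ∷ p) =
      trans (+-cong (zeroʳ c) (⟦⟧-zero p)) (+-identityˡ 0#)

    ⟦⟧-+ : ∀ p φ ψ → ⟦ p ⟧ (λ v → φ v + ψ v) ≈ ⟦ p ⟧ φ + ⟦ p ⟧ ψ
    ⟦⟧-+ []            φ ψ = sym (+-identityˡ 0#)
    ⟦⟧-+ ((c , v) ∷ p) φ ψ =
      trans (+-cong (distribˡ c _ _) (⟦⟧-+ p φ ψ)) (interchange _ _ _ _)

    ⟦⟧-* : ∀ p c φ → ⟦ p ⟧ (λ v → c * φ v) ≈ c * ⟦ p ⟧ φ
    ⟦⟧-* []            c φ = sym (zeroʳ c)
    ⟦⟧-* ((d , v) ∷ p) c φ =
      trans (+-cong (*-Props.x∙yz≈y∙xz d c (φ v)) (⟦⟧-* p c φ)) (sym (distribˡ c _ _))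

    ⟦⟧-scale : ∀ c v q φ → ⟦ scale c v q ⟧ φ ≈ c * ⟦ q ⟧ (λ w → φ (v ⊕ w))
    ⟦⟧-scale c v []            φ = sym (zeroʳ c)
    ⟦⟧-scale c v ((d , w) ∷ q) φ =
      trans (+-cong (*-assoc c d _) (⟦⟧-scale c v q φ)) (sym (distribˡ c _ _))

    ⟦⟧-⊛ : ∀ p q φ → ⟦ p ⊛ q ⟧ φ ≈ ⟦ p ⟧ (λ v → ⟦ q ⟧ (λ w → φ (v ⊕ w)))
    ⟦⟧-⊛ []            q φ = refl
    ⟦⟧-⊛ ((c , v) ∷ p) q φ =
      trans (⟦⟧-++ (scale c v q) (p ⊛ q) φ) (+-cong (⟦⟧-scale c v q φ) (⟦⟧-⊛ p q φ))

    ⟦⟧-swap : ∀ p q (φ : Monomial → Monomial → Carrier) →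
      ⟦ p ⟧ (λ v → ⟦ q ⟧ (λ w → φ v w)) ≈ ⟦ q ⟧ (λ w → ⟦ p ⟧ (λ v → φ v w))
    ⟦⟧-swap []            q φ = sym (⟦⟧-zero q)
    ⟦⟧-swap ((c , v) ∷ p) q φ = begin
      c * ⟦ q ⟧ (φ v) + ⟦ p ⟧ (λ u → ⟦ q ⟧ (φ u))
        ≈⟨ +-cong (sym (⟦⟧-* q c (φ v))) (⟦⟧-swap p q φ) ⟩
      ⟦ q ⟧ (λ w → c * φ v w) + ⟦ q ⟧ (λ w → ⟦ p ⟧ (λ u → φ u w))
        ≈⟨ ⟦⟧-+ q _ _ ⟨
      ⟦ q ⟧ (λ w → c * φ v w + ⟦ p ⟧ (λ u → φ u w)) ∎

    ⊕-comm : ∀ v w → v ⊕ w ≡ w ⊕ v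
    ⊕-comm = Vec.zipWith-comm ℕ.+-comm

    ⊕-assoc : ∀ u v w → (u ⊕ v) ⊕ w ≡ u ⊕ (v ⊕ w)
    ⊕-assoc = Vec.zipWith-assoc ℕ.+-assoc

    ⊕-identityˡ : ∀ v → 𝟎 ⊕ v ≡ v
    ⊕-identityˡ = Vec.zipWith-identityˡ ℕ.+-identityˡ

    ⊕-∸ : ∀ {m} (v w : Vec ℕ m) →
          Vec.zipWith _∸_ (Vec.zipWith ℕ._+_ v w) v ≡ w
    ⊕-∸ []      []      = ≡.refl
    ⊕-∸ (x ∷ v) (y ∷ w) = cong₂ _∷_ (ℕ.m+n∸m≡n x y) (⊕-∸ v w)

    δ-shift : ∀ m v u → v ⊕ u ≡ m → ∀ w → δ m (v ⊕ w) ≈ δ u w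
    δ-shift m v u eq w with (v ⊕ w) ≟ m | w ≟ u
    ... | yes _  | yes _  = refl
    ... | no  _  | no  _  = refl
    ... | yes e  | no  ne =
      contradiction
        (≡.trans (≡.sym (⊕-∸ v w))
          (≡.trans (cong (λ t → Vec.zipWith _∸_ t v) (≡.trans e (≡.sym eq))) (⊕-∸ v u)))
        ne
    ... | no  ne | yes ≡.refl = contradiction eq ne

    δ-miss : ∀ m v → ¬ (v ⊕ Vec.zipWith _∸_ m v ≡ m) → ∀ w → δ m (v ⊕ w) ≈ 0#
    δ-miss m v ne w with (v ⊕ w) ≟ m
    ... | no  _      = refl
    ... | yes ≡.refl = contradiction (cong (v ⊕_) (⊕-∸ v w)) ne

    ≋-shift : ∀ {p q} → p ≋ q → ∀ m v →
      ⟦ p ⟧ (λ w → δ m (v ⊕ w)) ≈ ⟦ q ⟧ (λ w → δ m (v ⊕ w))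
    ≋-shift {p} {q} p≋q m v with (v ⊕ Vec.zipWith _∸_ m v) ≟ m
    ... | yes e = begin
      ⟦ p ⟧ (λ w → δ m (v ⊕ w))  ≈⟨ ⟦⟧-cong p (δ-shift m v _ e) ⟩
      coeff p _                  ≈⟨ coeff-≈ p≋q _ ⟩
      coeff q _                  ≈⟨ ⟦⟧-cong q (δ-shift m v _ e) ⟨
      ⟦ q ⟧ (λ w → δ m (v ⊕ w))  ∎
    ... | no ne = begin
      ⟦ p ⟧ (λ w → δ m (v ⊕ w))  ≈⟨ ⟦⟧-cong p (δ-miss m v ne) ⟩
      ⟦ p ⟧ (λ _ → 0#)           ≈⟨ ⟦⟧-zero p ⟩
      0#                         ≈⟨ ⟦⟧-zero q ⟨
      ⟦ q ⟧ (λ _ → 0#)           ≈⟨ ⟦⟧-cong q (δ-miss m v ne) ⟨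
      ⟦ q ⟧ (λ w → δ m (v ⊕ w))  ∎

    from-⟦⟧ : ∀ {p q} → (∀ φ → ⟦ p ⟧ φ ≈ ⟦ q ⟧ φ) → p ≋ q
    from-⟦⟧ eq = mk≋ λ m → eq (δ m)

    ++-≋ : ∀ {p p′ q q′} → p ≋ p′ → q ≋ q′ → p ++ q ≋ p′ ++ q′
    ++-≋ {p} {p′} {q} {q′} e f = mk≋ λ m →
      trans (⟦⟧-++ p q _) (trans (+-cong (coeff-≈ e m) (coeff-≈ f m)) (sym (⟦⟧-++ p′ q′ _)))

    ≡⇒≈ : ∀ {x y} → x ≡ y → x ≈ y
    ≡⇒≈ ≡.refl = refl

    ⊛-comm : ∀ p q → p ⊛ q ≋ q ⊛ p
    ⊛-comm p q = from-⟦⟧ λ φ → begin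
      ⟦ p ⊛ q ⟧ φ                             ≈⟨ ⟦⟧-⊛ p q φ ⟩
      ⟦ p ⟧ (λ v → ⟦ q ⟧ (λ w → φ (v ⊕ w)))   ≈⟨ ⟦⟧-swap p q (λ v w → φ (v ⊕ w)) ⟩
      ⟦ q ⟧ (λ w → ⟦ p ⟧ (λ v → φ (v ⊕ w)))   ≈⟨ ⟦⟧-cong q (λ w → ⟦⟧-cong p λ v → ≡⇒≈ (cong φ (⊕-comm v w))) ⟩
      ⟦ q ⟧ (λ w → ⟦ p ⟧ (λ v → φ (w ⊕ v)))   ≈⟨ ⟦⟧-⊛ q p φ ⟨
      ⟦ q ⊛ p ⟧ φ                             ∎

    ⊛-assoc : ∀ p q r → (p ⊛ q) ⊛ r ≋ p ⊛ (q ⊛ r)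
    ⊛-assoc p q r = from-⟦⟧ λ φ → begin
      ⟦ (p ⊛ q) ⊛ r ⟧ φ
        ≈⟨ ⟦⟧-⊛ (p ⊛ q) r φ ⟩
      ⟦ p ⊛ q ⟧ (λ x → ⟦ r ⟧ (λ w → φ (x ⊕ w)))
        ≈⟨ ⟦⟧-⊛ p q _ ⟩
      ⟦ p ⟧ (λ u → ⟦ q ⟧ (λ v → ⟦ r ⟧ (λ w → φ ((u ⊕ v) ⊕ w))))
        ≈⟨ ⟦⟧-cong p (λ u → ⟦⟧-cong q λ v → ⟦⟧-cong r λ w → ≡⇒≈ (cong φ (⊕-assoc u v w))) ⟩
      ⟦ p ⟧ (λ u → ⟦ q ⟧ (λ v → ⟦ r ⟧ (λ w → φ (u ⊕ (v ⊕ w)))))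
        ≈⟨ ⟦⟧-cong p (λ u → ⟦⟧-⊛ q r _) ⟨
      ⟦ p ⟧ (λ u → ⟦ q ⊛ r ⟧ (λ x → φ (u ⊕ x)))
        ≈⟨ ⟦⟧-⊛ p (q ⊛ r) φ ⟨
      ⟦ p ⊛ (q ⊛ r) ⟧ φ ∎

    ⊛-identityˡ : ∀ p → 1ᴾ ⊛ p ≋ p
    ⊛-identityˡ p = from-⟦⟧ λ φ → begin
      ⟦ 1ᴾ ⊛ p ⟧ φ                          ≈⟨ ⟦⟧-⊛ 1ᴾ p φ ⟩
      1# * ⟦ p ⟧ (λ w → φ (𝟎 ⊕ w)) + 0#     ≈⟨ +-identityʳ _ ⟩
      1# * ⟦ p ⟧ (λ w → φ (𝟎 ⊕ w))          ≈⟨ *-identityˡ _ ⟩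
      ⟦ p ⟧ (λ w → φ (𝟎 ⊕ w))               ≈⟨ ⟦⟧-cong p (λ w → ≡⇒≈ (cong φ (⊕-identityˡ w))) ⟩
      ⟦ p ⟧ φ                               ∎

    ⊛-distribʳ : ∀ p q r → (q ++ r) ⊛ p ≋ (q ⊛ p) ++ (r ⊛ p)
    ⊛-distribʳ p q r = from-⟦⟧ λ φ → begin
      ⟦ (q ++ r) ⊛ p ⟧ φ               ≈⟨ ⟦⟧-⊛ (q ++ r) p φ ⟩
      ⟦ q ++ r ⟧ _                     ≈⟨ ⟦⟧-++ q r _ ⟩
      ⟦ q ⟧ _ + ⟦ r ⟧ _                ≈⟨ +-cong (⟦⟧-⊛ q p φ) (⟦⟧-⊛ r p φ) ⟨
      ⟦ q ⊛ p ⟧ φ + ⟦ r ⊛ p ⟧ φ        ≈⟨ ⟦⟧-++ (q ⊛ p) (r ⊛ p) φ ⟨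
      ⟦ (q ⊛ p) ++ (r ⊛ p) ⟧ φ         ∎

    ≋-refl : ∀ {p} → p ≋ p
    ≋-refl = mk≋ λ _ → refl

    ≋-sym : ∀ {p q} → p ≋ q → q ≋ p
    ≋-sym e = mk≋ λ m → sym (coeff-≈ e m)

    ≋-trans : ∀ {p q r} → p ≋ q → q ≋ r → p ≋ r
    ≋-trans e f = mk≋ λ m → trans (coeff-≈ e m) (coeff-≈ f m)

    ⊛-congˡ : ∀ p {q q′} → q ≋ q′ → p ⊛ q ≋ p ⊛ q′
    ⊛-congˡ p {q} {q′} e = mk≋ λ m → begin
      ⟦ p ⊛ q ⟧ (δ m)                             ≈⟨ ⟦⟧-⊛ p q (δ m) ⟩
      ⟦ p ⟧ (λ v → ⟦ q ⟧ (λ w → δ m (v ⊕ w)))     ≈⟨ ⟦⟧-cong p (≋-shift e m) ⟩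
      ⟦ p ⟧ (λ v → ⟦ q′ ⟧ (λ w → δ m (v ⊕ w)))    ≈⟨ ⟦⟧-⊛ p q′ (δ m) ⟨
      ⟦ p ⊛ q′ ⟧ (δ m)                            ∎

    ++-comm : ∀ p q → p ++ q ≋ q ++ p
    ++-comm p q = from-⟦⟧ λ φ →
      trans (⟦⟧-++ p q φ) (trans (+-comm _ _) (sym (⟦⟧-++ q p φ)))

    ++-assoc : ∀ p q r → (p ++ q) ++ r ≋ p ++ (q ++ r)
    ++-assoc p q r = from-⟦⟧ λ φ → begin
      ⟦ (p ++ q) ++ r ⟧ φ              ≈⟨ ⟦⟧-++ (p ++ q) r φ ⟩
      ⟦ p ++ q ⟧ φ + ⟦ r ⟧ φ           ≈⟨ +-congʳ (⟦⟧-++ p q φ) ⟩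
      (⟦ p ⟧ φ + ⟦ q ⟧ φ) + ⟦ r ⟧ φ    ≈⟨ +-assoc _ _ _ ⟩
      ⟦ p ⟧ φ + (⟦ q ⟧ φ + ⟦ r ⟧ φ)    ≈⟨ +-congˡ (⟦⟧-++ q r φ) ⟨
      ⟦ p ⟧ φ + ⟦ q ++ r ⟧ φ           ≈⟨ ⟦⟧-++ p (q ++ r) φ ⟨
      ⟦ p ++ (q ++ r) ⟧ φ              ∎

    ⊖-inverseˡ : ∀ p → (⊖ p) ++ p ≋ []
    ⊖-inverseˡ p = from-⟦⟧ λ φ →
      trans (⟦⟧-++ (⊖ p) p φ) (trans (+-congʳ (⟦⟧-⊖ p φ)) (-‿inverseˡ _))

  polynomialRing : CommutativeRing k ℓ
  polynomialRing = record
    { Carrier = Poly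
    ; _≈_ = _≋_
    ; _+_ = _++_
    ; _*_ = _⊛_
    ; -_  = ⊖_
    ; 0#  = 0ᴾ
    ; 1#  = 1ᴾ
    ; isCommutativeRing = record
      { isRing = record
        { +-isAbelianGroup = record
          { isGroup = record
            { isMonoid = record
              { isSemigroup = record
                { isMagma = record
                  { isEquivalence = record { refl = ≋-refl ; sym = ≋-sym ; trans = ≋-trans }
                  ; ∙-cong = ++-≋
                  }
                ; assoc = ++-assoc
                }
              ; identity = (λ _ → ≋-refl) , (λ p → ≋-trans (++-comm p []) ≋-refl)
              }
            ; inverse = ⊖-inverseˡ , (λ p → ≋-trans (++-comm p (⊖ p)) (⊖-inverseˡ p))
            ; ⁻¹-cong = λ {p} {q} e → mk≋ λ m →
                trans (⟦⟧-⊖ p _) (trans (-‿cong (coeff-≈ e m)) (sym (⟦⟧-⊖ q _)))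
            }
          ; comm = ++-comm
          }
        ; *-cong = λ {p} {p′} {q} {q′} e f →
            ≋-trans (⊛-congˡ p f)
              (≋-trans (⊛-comm p q′) (≋-trans (⊛-congˡ q′ e) (⊛-comm q′ p′)))
        ; *-assoc = ⊛-assoc
        ; *-identity = ⊛-identityˡ , (λ p → ≋-trans (⊛-comm p 1ᴾ) (⊛-identityˡ p))
        ; distrib =
            (λ p q r → ≋-trans (⊛-comm p (q ++ r))
              (≋-trans (⊛-distribʳ p q r) (++-≋ (⊛-comm q p) (⊛-comm r p))))
          , ⊛-distribʳ
        }
      ; *-comm = ⊛-comm
      }
    }

{-# OPTIONS --safe #-}

-- Write α, β, γ for the three exponents of the Las Vergnas polynomial.  All
-- three are additive along chains B ⊆ A ⊆ D ⊆ E, so once D = C ∪ A the (A, B, C)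
-- term of the right-hand side is (-1)^∣C∣ h(B, D) with h independent of A.
-- Summing the sign over all A between B and D leaves only B = A = D, and h(A, A)
-- is the A-term of the left-hand side.

module Submission where

open import Defs
open import Algebra.Bundles using (CommutativeRing)
import Algebra.Properties.CommutativeSemigroup as CommutativeSemigroupProperties
import Algebra.Properties.CommutativeSemiring.Exp as Exp
import Algebra.Properties.Ring as RingProperties
import Algebra.Solver.CommutativeMonoid as CommutativeMonoidSolver
open import Data.Fin.Patterns using (0F; 1F; 2F; 3F; 4F; 5F)
open import Data.Fin.Subset
  using (Subset; inside; outside; _⊆_; _∪_; _∩_; _─_; ∣_∣)
import Data.Fin.Subset.Properties as Subset
open import Data.Nat.Base using (ℕ; zero; suc; _≤_; _∸_)
import Data.Nat.Base as ℕ
import Data.Nat.Properties as ℕ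
open import Data.Product.Base using (_,_)
open import Data.Sum.Base using ([_,_]′)
open import Data.Vec.Base using ([]; _∷_; here)
open import Function.Base using (_∘_; id)
open import Level using (Level)
open import Relation.Binary.PropositionalEquality as ≡ using (_≡_; cong; cong₂)
import Relation.Binary.Reasoning.Setoid as SetoidReasoning

private
  module ℕ-+ = CommutativeSemigroupProperties ℕ.+-commutativeSemigroup

  variable
    k ℓ : Level
    n : ℕ

-- Arithmetic of exact differences, and disjoint unions of subsets.

∸-telescope : ∀ {m n o} → m ≤ n → n ≤ o → o ∸ m ≡ (n ∸ m) ℕ.+ (o ∸ n)
∸-telescope {m} m≤n n≤o with ℕ.m≤n⇒∃[o]m+o≡n m≤n | ℕ.m≤n⇒∃[o]m+o≡n n≤o
... | i , ≡.refl | j , ≡.refl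
  rewrite ℕ.m+n∸m≡n m i | ℕ.m+n∸m≡n (m ℕ.+ i) j | ℕ.+-assoc m i j =
  ℕ.m+n∸m≡n m (i ℕ.+ j)

+-∸-interchange : ∀ {m n o p} → n ≤ m → p ≤ o →
                  (m ℕ.+ o) ∸ (n ℕ.+ p) ≡ (m ∸ n) ℕ.+ (o ∸ p)
+-∸-interchange {n = n} {p = p} n≤m p≤o
  with ℕ.m≤n⇒∃[o]m+o≡n n≤m | ℕ.m≤n⇒∃[o]m+o≡n p≤o
... | i , ≡.refl | j , ≡.refl
  rewrite ℕ.m+n∸m≡n n i | ℕ.m+n∸m≡n p j | ℕ-+.interchange n i p j =
  ℕ.m+n∸m≡n (n ℕ.+ p) (i ℕ.+ j)

∸-∸-cancel : ∀ {m n} o → m ≤ n → (o ∸ m) ∸ (n ∸ m) ≡ o ∸ n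
∸-∸-cancel {m} {n} o m≤n =
  ≡.trans (ℕ.∸-+-assoc o m (n ∸ m)) (cong (o ∸_) (ℕ.m+[n∸m]≡n m≤n))

─-∪-cancel : ∀ {A E : Subset n} → A ⊆ E → (E ─ A) ∪ A ≡ E
─-∪-cancel {A = []}          {[]}          A⊆E = ≡.refl
─-∪-cancel {A = outside ∷ A} {outside ∷ E} A⊆E =
  cong (outside ∷_) (─-∪-cancel (Subset.drop-∷-⊆ A⊆E))
─-∪-cancel {A = outside ∷ A} {inside ∷ E}  A⊆E =
  cong (inside ∷_) (─-∪-cancel (Subset.drop-∷-⊆ A⊆E))
─-∪-cancel {A = inside ∷ A}  {outside ∷ E} A⊆E with () ← A⊆E here
─-∪-cancel {A = inside ∷ A}  {inside ∷ E}  A⊆E =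
  cong (inside ∷_) (─-∪-cancel (Subset.drop-∷-⊆ A⊆E))

∣∪∣-disjoint : ∀ (A E : Subset n) {C} → C ⊆ E ─ A → ∣ C ∪ A ∣ ≡ ∣ A ∣ ℕ.+ ∣ C ∣
∣∪∣-disjoint []            []      {[]}          C⊆ = ≡.refl
∣∪∣-disjoint (outside ∷ A) (x ∷ E) {outside ∷ C} C⊆ =
  ∣∪∣-disjoint A E (Subset.drop-∷-⊆ C⊆)
∣∪∣-disjoint (outside ∷ A) (x ∷ E) {inside ∷ C}  C⊆ =
  ≡.trans (cong suc (∣∪∣-disjoint A E (Subset.drop-∷-⊆ C⊆))) (≡.sym (ℕ.+-suc _ _))
∣∪∣-disjoint (inside ∷ A)  (x ∷ E) {outside ∷ C} C⊆ =
  cong suc (∣∪∣-disjoint A E (Subset.drop-∷-⊆ C⊆))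
∣∪∣-disjoint (inside ∷ A)  (x ∷ E) {inside ∷ C}  C⊆ with () ← C⊆ here

∪-lub : ∀ {A B C : Subset n} → A ⊆ C → B ⊆ C → A ∪ B ⊆ C
∪-lub {A = A} {B} A⊆C B⊆C = [ A⊆C , B⊆C ]′ ∘ Subset.x∈p∪q⁻ A B

-- Additivity of the exponents along chains.

module Exponents {E : Subset n} (P : MatroidPerspective E) where
  open MatroidPerspective P
  open Matroid M public using (rk-bounded; rk-monotone; rk-submodular)
  open Matroid M′ public using () renaming (rk-monotone to rk′-monotone)

  -- Two arguments let one function serve `P` and both minors: the exponents are `α A E` for `P`,
  -- `α B A` for the restriction to `A`, and `α (C ∪ A) E` for the contraction by `A`; likewise for
  -- `γ`.
  α γ : Subset n → Subset n → ℕ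
  α A B = rk′ B ∸ rk′ A
  γ A B = (rk B ∸ rk A) ∸ α A B

  β : Subset n → ℕ
  β A = ∣ A ∣ ∸ rk A

  -- The nullity of `C` in the contraction of `M` by `A`.
  β/ : Subset n → Subset n → ℕ
  β/ A C = ∣ C ∣ ∸ (rk (C ∪ A) ∸ rk A)

  α-telescope : ∀ {A B C} → A ⊆ B → B ⊆ C → C ⊆ E → α A C ≡ α A B ℕ.+ α B C
  α-telescope A⊆B B⊆C C⊆E =
    ∸-telescope (rk′-monotone A⊆B (C⊆E ∘ B⊆C)) (rk′-monotone B⊆C C⊆E)

  -- The perspective inequality on each half of the chain makes both truncated differences exact, so
  -- a difference of sums splits into a sum of differences.
  γ-telescope : ∀ {A B C} → A ⊆ B → B ⊆ C → C ⊆ E → γ A C ≡ γ A B ℕ.+ γ B C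
  γ-telescope A⊆B B⊆C C⊆E = ≡.trans
    (cong₂ _∸_ (∸-telescope (rk-monotone A⊆B (C⊆E ∘ B⊆C)) (rk-monotone B⊆C C⊆E))
               (α-telescope A⊆B B⊆C C⊆E))
    (+-∸-interchange (perspective A⊆B (C⊆E ∘ B⊆C)) (perspective B⊆C C⊆E))

  α+γ : ∀ {A B} → A ⊆ B → B ⊆ E → α A B ℕ.+ γ A B ≡ rk B ∸ rk A
  α+γ A⊆B B⊆E = ℕ.m+[n∸m]≡n (perspective A⊆B B⊆E)

  module _ {A C : Subset n} (A⊆E : A ⊆ E) (C⊆ : C ⊆ E ─ A) where
    A⊆C∪A : A ⊆ C ∪ A
    A⊆C∪A = Subset.q⊆p∪q C A

    C⊆E : C ⊆ E
    C⊆E = Subset.p─q⊆p E A ∘ C⊆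

    C∪A⊆E : C ∪ A ⊆ E
    C∪A⊆E = ∪-lub C⊆E A⊆E

    -- This makes the subtraction in `β/` exact.
    rk-increment : rk (C ∪ A) ∸ rk A ≤ ∣ C ∣
    rk-increment = ℕ.m≤n+o⇒m∸n≤o _ (rk A) (begin
      rk (C ∪ A)                  ≤⟨ ℕ.m≤m+n _ _ ⟩
      rk (C ∪ A) ℕ.+ rk (C ∩ A)   ≤⟨ rk-submodular C⊆E A⊆E ⟩
      rk C ℕ.+ rk A               ≤⟨ ℕ.+-monoˡ-≤ (rk A) (rk-bounded C⊆E) ⟩
      ∣ C ∣ ℕ.+ rk A              ≡⟨ ℕ.+-comm ∣ C ∣ (rk A) ⟩
      rk A ℕ.+ ∣ C ∣              ∎)
      where open ℕ.≤-Reasoning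

    -- Cardinality is additive because `C` and `A` are disjoint, and the rank of `C ∪ A` is that of
    -- `A` plus the increment; the two nullities are then subtracted separately.
    β-∪ : β (C ∪ A) ≡ β A ℕ.+ β/ A C
    β-∪ = ≡.trans
      (cong₂ _∸_ (∣∪∣-disjoint A E C⊆)
        (≡.sym (ℕ.m+[n∸m]≡n (rk-monotone A⊆C∪A C∪A⊆E))))
      (+-∸-interchange (rk-bounded A⊆E) rk-increment)

    α-contract : ∀ D → (rk′ D ∸ rk′ A) ∸ (rk′ (C ∪ A) ∸ rk′ A) ≡ α (C ∪ A) D
    α-contract D = ∸-∸-cancel (rk′ D) (rk′-monotone A⊆C∪A C∪A⊆E)

    γ-contract : ∀ D →
      ((rk D ∸ rk A) ∸ (rk (C ∪ A) ∸ rk A)) ∸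
      ((rk′ D ∸ rk′ A) ∸ (rk′ (C ∪ A) ∸ rk′ A)) ≡ γ (C ∪ A) D
    γ-contract D =
      cong₂ _∸_ (∸-∸-cancel (rk D) (rk-monotone A⊆C∪A C∪A⊆E)) (α-contract D)

    -- The left side collects the exponents of all factors `- 1#` split off in `term-≈`. Pairing `α`
    -- with `γ` eliminates `rk′`; then `v` and `y` add up to `∣ C ∣`, while `w` occurs twice and
    -- cannot affect the sign.
    sign-parity : ((α A E ℕ.+ γ A E) ℕ.+ β/ A C) ℕ.+ (α (C ∪ A) E ℕ.+ γ (C ∪ A) E) ≡
                  ∣ C ∣ ℕ.+ ((rank ∸ rk (C ∪ A)) ℕ.+ (rank ∸ rk (C ∪ A)))
    sign-parity = begin
      ((α A E ℕ.+ γ A E) ℕ.+ y) ℕ.+ (α (C ∪ A) E ℕ.+ γ (C ∪ A) E)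
        ≡⟨ cong₂ (λ s t → (s ℕ.+ y) ℕ.+ t) (α+γ {A} A⊆E id) (α+γ {C ∪ A} C∪A⊆E id) ⟩
      ((rank ∸ rk A) ℕ.+ y) ℕ.+ w
        ≡⟨ cong (λ s → (s ℕ.+ y) ℕ.+ w)
             (∸-telescope (rk-monotone A⊆C∪A C∪A⊆E) (rk-monotone C∪A⊆E id)) ⟩
      ((v ℕ.+ w) ℕ.+ y) ℕ.+ w
        ≡⟨ cong (ℕ._+ w) (ℕ-+.xy∙z≈xz∙y v w y) ⟩
      ((v ℕ.+ y) ℕ.+ w) ℕ.+ w
        ≡⟨ ℕ.+-assoc (v ℕ.+ y) w w ⟩
      (v ℕ.+ y) ℕ.+ (w ℕ.+ w)
        ≡⟨ cong (ℕ._+ (w ℕ.+ w)) (ℕ.m+[n∸m]≡n rk-increment) ⟩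
      ∣ C ∣ ℕ.+ (w ℕ.+ w) ∎
      where
      open ≡.≡-Reasoning
      v = rk (C ∪ A) ∸ rk A
      w = rank ∸ rk (C ∪ A)
      y = β/ A C

module _ (R : CommutativeRing k ℓ) where
  open CommutativeRing R hiding (zero)
  open LasVergnas R hiding (_^_)
  open Exp commutativeSemiring
  open RingProperties ring
    using (-‿+-comm; -‿distribˡ-*; -‿involutive; -1*x≈-x)
  open CommutativeSemigroupProperties +-commutativeSemigroup using (interchange)
  open SetoidReasoning setoid

  -- Linearity of sums over subsets.

  ∑⊆-cong : ∀ (E : Subset n) {f g : ∀ A → A ⊆ E → Carrier} →
            (∀ A (A⊆E : A ⊆ E) → f A A⊆E ≈ g A A⊆E) → ∑⊆ E f ≈ ∑⊆ E g
  ∑⊆-cong []            f≈g = f≈g _ _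
  ∑⊆-cong (outside ∷ E) f≈g = ∑⊆-cong E λ _ _ → f≈g _ _
  ∑⊆-cong (inside  ∷ E) f≈g =
    +-cong (∑⊆-cong E λ _ _ → f≈g _ _) (∑⊆-cong E λ _ _ → f≈g _ _)

  ∑⊆-+ : ∀ (E : Subset n) (f g : ∀ A → A ⊆ E → Carrier) →
         ∑⊆ E (λ A A⊆E → f A A⊆E + g A A⊆E) ≈ ∑⊆ E f + ∑⊆ E g
  ∑⊆-+ []            f g = refl
  ∑⊆-+ (outside ∷ E) f g = ∑⊆-+ E _ _
  ∑⊆-+ (inside  ∷ E) f g =
    trans (+-cong (∑⊆-+ E _ _) (∑⊆-+ E _ _)) (interchange _ _ _ _)

  *-∑⊆ : ∀ (E : Subset n) x (f : ∀ A → A ⊆ E → Carrier) →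
         x * ∑⊆ E f ≈ ∑⊆ E (λ A A⊆E → x * f A A⊆E)
  *-∑⊆ []            x f = refl
  *-∑⊆ (outside ∷ E) x f = *-∑⊆ E x _
  *-∑⊆ (inside  ∷ E) x f =
    trans (distribˡ x _ _) (+-cong (*-∑⊆ E x _) (*-∑⊆ E x _))

  ∑⊆-* : ∀ (E : Subset n) x (f : ∀ A → A ⊆ E → Carrier) →
         ∑⊆ E f * x ≈ ∑⊆ E (λ A A⊆E → f A A⊆E * x)
  ∑⊆-* E x f =
    trans (*-comm _ x) (trans (*-∑⊆ E x f) (∑⊆-cong E λ _ _ → *-comm x _))

  ∑⊆-neg : ∀ (E : Subset n) (f : ∀ A → A ⊆ E → Carrier) →
           ∑⊆ E (λ A A⊆E → - f A A⊆E) ≈ - ∑⊆ E f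
  ∑⊆-neg []            f = refl
  ∑⊆-neg (outside ∷ E) f = ∑⊆-neg E _
  ∑⊆-neg (inside  ∷ E) f =
    trans (+-cong (∑⊆-neg E _) (∑⊆-neg E _)) (-‿+-comm _ _)

  -- Powers of minus one and of negated elements.

  sign : ℕ → Carrier
  sign m = (- 1#) ^ m

  sign-suc-* : ∀ m x → sign (suc m) * x ≈ - (sign m * x)
  sign-suc-* m x = trans (*-assoc _ _ _) (-1*x≈-x _)

  sign-square : ∀ m → sign m * sign m ≈ 1#
  sign-square zero    = *-identityˡ 1#
  sign-square (suc m) = begin
    sign (suc m) * sign (suc m)   ≈⟨ ^-distrib-* (- 1#) (- 1#) (suc m) ⟨
    (- 1# * - 1#) ^ suc m         ≈⟨ *-congʳ -1*-1≈1 ⟩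
    1# * (- 1# * - 1#) ^ m        ≈⟨ *-identityˡ _ ⟩
    (- 1# * - 1#) ^ m             ≈⟨ ^-distrib-* (- 1#) (- 1#) m ⟩
    sign m * sign m               ≈⟨ sign-square m ⟩
    1#                            ∎
    where
    -1*-1≈1 : - 1# * - 1# ≈ 1#
    -1*-1≈1 = trans (-1*x≈-x (- 1#)) (-‿involutive 1#)

  sign-+-double : ∀ m l → sign (m ℕ.+ (l ℕ.+ l)) ≈ sign m
  sign-+-double m l = begin
    sign (m ℕ.+ (l ℕ.+ l))     ≈⟨ ^-homo-* (- 1#) m (l ℕ.+ l) ⟩
    sign m * sign (l ℕ.+ l)    ≈⟨ *-congˡ (^-homo-* (- 1#) l l) ⟩
    sign m * (sign l * sign l) ≈⟨ *-congˡ (sign-square l) ⟩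
    sign m * 1#                ≈⟨ *-identityʳ _ ⟩
    sign m                     ∎

  -^ : ∀ x m → (- x) ^ m ≈ sign m * x ^ m
  -^ x m = trans (^-congˡ m (sym (-1*x≈-x x))) (^-distrib-* (- 1#) x m)

  -- In the convolution the prefactor has powers of `a` and `e`, the restriction powers of `- a` and
  -- `- e`; this brings them to a common base.
  ^-via-neg : ∀ x m → x ^ m ≈ sign m * (- x) ^ m
  ^-via-neg x m = trans (^-congˡ m (sym (-‿involutive x))) (-^ (- x) m)

  1-x-1≈-x : ∀ x → (1# - x) - 1# ≈ - x
  1-x-1≈-x x = begin
    (1# - x) - 1#    ≈⟨ +-congʳ (+-comm 1# (- x)) ⟩
    (- x + 1#) - 1#  ≈⟨ +-assoc (- x) 1# (- 1#) ⟩
    - x + (1# - 1#)  ≈⟨ +-congˡ (-‿inverseʳ 1#) ⟩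
    - x + 0#         ≈⟨ +-identityʳ (- x) ⟩
    - x              ∎

  [-xy]^ : ∀ x y m → (- (x * y)) ^ m ≈ (- x) ^ m * y ^ m
  [-xy]^ x y m = trans (^-congˡ m (-‿distribˡ-* x y)) (^-distrib-* (- x) y m)

  -- Alternating triple sums.

  -- Summands see bare subsets without inclusion proofs, so an induction on `E` can simply prefix a
  -- bit to the arguments of `h`.
  ∑₃ : ∀ (E : Subset n) → (Subset n → Subset n → Subset n → Carrier) → Carrier
  ∑₃ E f = ∑⊆ E λ A _ → ∑⊆ A λ B _ → ∑⊆ (E ─ A) λ C _ → f A B C

  ∑₃-cong : ∀ (E : Subset n) {f g : Subset n → Subset n → Subset n → Carrier} →
            (∀ A B C → f A B C ≈ g A B C) → ∑₃ E f ≈ ∑₃ E g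
  ∑₃-cong E f≈g =
    ∑⊆-cong E λ A _ → ∑⊆-cong A λ B _ → ∑⊆-cong (E ─ A) λ C _ → f≈g A B C

  ∑₃-neg : ∀ (E : Subset n) f → ∑₃ E (λ A B C → - f A B C) ≈ - ∑₃ E f
  ∑₃-neg E f = trans
    (∑⊆-cong E λ A _ → trans (∑⊆-cong A λ _ _ → ∑⊆-neg (E ─ A) _) (∑⊆-neg A _))
    (∑⊆-neg E _)

  -- Collecting the terms with C ∪ A = D turns the left side into the sum of
  -- (-1)^∣D ─ A∣ h B D over chains B ⊆ A ⊆ D, and the signs cancel unless B = D.
  ∑₃-alternating : ∀ (E : Subset n) (h : Subset n → Subset n → Carrier) →
    ∑₃ E (λ A B C → sign ∣ C ∣ * h B (C ∪ A)) ≈ ∑⊆ E (λ A _ → h A A)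
  ∑₃-alternating []            h = *-identityˡ _
  ∑₃-alternating (outside ∷ E) h =
    ∑₃-alternating E λ B D → h (outside ∷ B) (outside ∷ D)
  -- The first element of the ground set lies in no set, in `C`, in `A` but not `B`, or in both `A`
  -- and `B`. The two middle cases give the same pair of bits for `B` and `D`, but membership in `C`
  -- adds a sign, so they cancel. The letters of `oo`, `oi`, `ii` are the bits of `B` and `D`.
  ∑₃-alternating (inside  ∷ E) h = begin
    ∑⊆ E (λ A _ → ∑⊆ A λ B _ → ∑⊆ (E ─ A) (λ C _ → t oo A B C) +
                               ∑⊆ (E ─ A) (λ C _ → sign (suc ∣ C ∣) * oi B (C ∪ A))) +
    ∑⊆ E (λ A _ → ∑⊆ A (λ B _ → ∑⊆ (E ─ A) λ C _ → t oi A B C) +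
                  ∑⊆ A (λ B _ → ∑⊆ (E ─ A) λ C _ → t ii A B C))
      ≈⟨ +-cong
           (trans (∑⊆-cong E λ A _ → ∑⊆-+ A _ _) (∑⊆-+ E _ _))
           (∑⊆-+ E _ _) ⟩
    (∑₃ E (t oo) + ∑₃ E (λ A B C → sign (suc ∣ C ∣) * oi B (C ∪ A))) +
    (∑₃ E (t oi) + ∑₃ E (t ii))
      ≈⟨ +-congʳ (+-congˡ
           (trans (∑₃-cong E λ A B C → sign-suc-* ∣ C ∣ _) (∑₃-neg E (t oi)))) ⟩
    (∑₃ E (t oo) - ∑₃ E (t oi)) + (∑₃ E (t oi) + ∑₃ E (t ii))
      ≈⟨ +-assoc _ _ _ ⟩
    ∑₃ E (t oo) + (- ∑₃ E (t oi) + (∑₃ E (t oi) + ∑₃ E (t ii)))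
      ≈⟨ +-congˡ (+-assoc _ _ _) ⟨
    ∑₃ E (t oo) + ((- ∑₃ E (t oi) + ∑₃ E (t oi)) + ∑₃ E (t ii))
      ≈⟨ +-congˡ (trans (+-congʳ (-‿inverseˡ _)) (+-identityˡ _)) ⟩
    ∑₃ E (t oo) + ∑₃ E (t ii)
      ≈⟨ +-cong (∑₃-alternating E oo) (∑₃-alternating E ii) ⟩
    ∑⊆ E (λ A _ → oo A A) + ∑⊆ E (λ A _ → ii A A) ∎
    where
    oo oi ii : Subset _ → Subset _ → Carrier
    oo B D = h (outside ∷ B) (outside ∷ D)
    oi B D = h (outside ∷ B) (inside  ∷ D)
    ii B D = h (inside  ∷ B) (inside  ∷ D)
    t : (Subset _ → Subset _ → Carrier) → Subset _ → Subset _ → Subset _ → Carrier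
    t g A B C = sign ∣ C ∣ * g B (C ∪ A)

  private module Solver = CommutativeMonoidSolver *-commutativeMonoid

  -- The convolution formula at elements of a commutative ring.

  module _ {E : Subset n} (P : MatroidPerspective E) (a b c d e f : Carrier) where
    open MatroidPerspective P
    open Exponents P

    -- The lower set `B` governs the variables of the restriction, the upper set `D` those of the
    -- contraction. The minus signs are placed on `a`, `c`, `e`, so that at `B = D` the bases
    -- multiply to `- (a * b)`, `- (c * d)`, `- (e * f)`.
    h : Subset n → Subset n → Carrier
    h B D = ((- a) ^ α B E * (- c) ^ β B * (- e) ^ γ B E) *
            (b ^ α D E * d ^ β D * f ^ γ D E)

    diagonal : ∀ A →
      ((1# - a * b) - 1#) ^ α A E * ((1# - c * d) - 1#) ^ β A * (- (e * f)) ^ γ A E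
        ≈ h A A
    diagonal A = trans
      (*-cong (*-cong (trans (^-congˡ (α A E) (1-x-1≈-x (a * b))) ([-xy]^ a b (α A E)))
                      (trans (^-congˡ (β A) (1-x-1≈-x (c * d))) ([-xy]^ c d (β A))))
              ([-xy]^ e f (γ A E)))
      (Solver.solve 6
        (λ a b c d e f → ((a ⊕ b) ⊕ (c ⊕ d)) ⊕ (e ⊕ f) ⊜
                         ((a ⊕ c) ⊕ e) ⊕ ((b ⊕ d) ⊕ f))
        refl _ _ _ _ _ _)
      where open Solver using (_⊕_; _⊜_)

    -- Left unsimplified so that its sum over `B` is, by unfolding, `𝔗` of the restriction.
    restrictTerm : Subset n → Subset n → Carrier
    restrictTerm A B =
      ((1# - a) - 1#) ^ α B A * ((1# - c) - 1#) ^ β B * (- e) ^ γ B A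

    -- D is the ground set: P / A takes its rank at (E ─ A) ∪ A, which is equal
    -- to E only propositionally.
    contractTerm : Subset n → Subset n → Subset n → Carrier
    contractTerm D A C =
      ((1# - b) - 1#) ^ ((rk′ D ∸ rk′ A) ∸ (rk′ (C ∪ A) ∸ rk′ A)) *
      ((1# - d) - 1#) ^ β/ A C *
      (- f) ^ (((rk D ∸ rk A) ∸ (rk (C ∪ A) ∸ rk A)) ∸
               ((rk′ D ∸ rk′ A) ∸ (rk′ (C ∪ A) ∸ rk′ A)))

    contractTerm-≈ : ∀ {A C} → A ⊆ E → C ⊆ E ─ A →
      contractTerm ((E ─ A) ∪ A) A C ≈
      (- b) ^ α (C ∪ A) E * (- d) ^ β/ A C * (- f) ^ γ (C ∪ A) E
    contractTerm-≈ {A} {C} A⊆E C⊆ rewrite ─-∪-cancel A⊆E =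
      *-cong (*-cong (^-cong (1-x-1≈-x b) (α-contract A⊆E C⊆ E))
                     (^-congˡ (β/ A C) (1-x-1≈-x d)))
             (^-congʳ (- f) (γ-contract A⊆E C⊆ E))

    sign-∣C∣ : ∀ {A C} → A ⊆ E → C ⊆ E ─ A →
      ((sign (α A E) * sign (γ A E)) * sign (β/ A C)) *
      (sign (α (C ∪ A) E) * sign (γ (C ∪ A) E)) ≈ sign ∣ C ∣
    sign-∣C∣ {A} {C} A⊆E C⊆ = begin
      ((sign i * sign j) * sign l) * (sign p * sign q)
        ≈⟨ *-cong (*-congʳ (^-homo-* s i j)) (^-homo-* s p q) ⟨
      (sign (i ℕ.+ j) * sign l) * sign (p ℕ.+ q)
        ≈⟨ *-congʳ (^-homo-* s (i ℕ.+ j) l) ⟨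
      sign ((i ℕ.+ j) ℕ.+ l) * sign (p ℕ.+ q)
        ≈⟨ ^-homo-* s ((i ℕ.+ j) ℕ.+ l) (p ℕ.+ q) ⟨
      sign (((i ℕ.+ j) ℕ.+ l) ℕ.+ (p ℕ.+ q))
        ≈⟨ ^-congʳ s (sign-parity A⊆E C⊆) ⟩
      sign (∣ C ∣ ℕ.+ (w ℕ.+ w))
        ≈⟨ sign-+-double ∣ C ∣ w ⟩
      sign ∣ C ∣ ∎
      where
      s = - 1#
      i = α A E
      j = γ A E
      l = β/ A C
      p = α (C ∪ A) E
      q = γ (C ∪ A) E
      w = rank ∸ rk (C ∪ A)

    -- Dependence on `A` disappears by merging: powers of `- a` and `- e` telescope along
    -- `B ⊆ A ⊆ E`, and powers of `d` add up from `A` to `C ∪ A`.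
    term-≈ : ∀ {A B C} → A ⊆ E → B ⊆ A → C ⊆ E ─ A →
      (a ^ α A E * d ^ β A * e ^ γ A E * restrictTerm A B) *
      contractTerm ((E ─ A) ∪ A) A C ≈ sign ∣ C ∣ * h B (C ∪ A)
    term-≈ {A} {B} {C} A⊆E B⊆A C⊆ = begin
      (a ^ α A E * d ^ β A * e ^ γ A E * restrictTerm A B) *
      contractTerm ((E ─ A) ∪ A) A C
        -- Bases are normalised as in `h`: negated for `a`, `c`, `e`, plain for `b`, `d`, `f`, with
        -- the remaining signs split off.
        ≈⟨ *-cong
             (*-cong
               (*-cong (*-congʳ (^-via-neg a (α A E))) (^-via-neg e (γ A E)))
               (*-congʳ (*-cong (^-congˡ (α B A) (1-x-1≈-x a))
                                (^-congˡ (β B) (1-x-1≈-x c)))))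
             (trans (contractTerm-≈ A⊆E C⊆)
               (*-cong (*-cong (-^ b (α (C ∪ A) E)) (-^ d (β/ A C)))
                       (-^ f (γ (C ∪ A) E)))) ⟩
      (sign (α A E) * (- a) ^ α A E) * d ^ β A * (sign (γ A E) * (- e) ^ γ A E) *
      ((- a) ^ α B A * (- c) ^ β B * (- e) ^ γ B A) *
      ((sign (α (C ∪ A) E) * b ^ α (C ∪ A) E) * (sign (β/ A C) * d ^ β/ A C) *
       (sign (γ (C ∪ A) E) * f ^ γ (C ∪ A) E))
        -- The five signs move to the front in the order of `sign-∣C∣`, and powers of equal base
        -- become adjacent.
        ≈⟨ Solver.solve 14
             (λ s₁ a₁ d₁ s₂ e₁ a₂ c e₂ s₃ b s₄ d₂ s₅ f →
               ((((s₁ ⊕ a₁) ⊕ d₁) ⊕ (s₂ ⊕ e₁)) ⊕ ((a₂ ⊕ c) ⊕ e₂)) ⊕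
               (((s₃ ⊕ b) ⊕ (s₄ ⊕ d₂)) ⊕ (s₅ ⊕ f)) ⊜
               (((s₁ ⊕ s₂) ⊕ s₄) ⊕ (s₃ ⊕ s₅)) ⊕
               ((((a₂ ⊕ a₁) ⊕ c) ⊕ (e₂ ⊕ e₁)) ⊕ ((b ⊕ (d₁ ⊕ d₂)) ⊕ f)))
             refl _ _ _ _ _ _ _ _ _ _ _ _ _ _ ⟩
      ((sign (α A E) * sign (γ A E)) * sign (β/ A C)) *
      (sign (α (C ∪ A) E) * sign (γ (C ∪ A) E)) *
      (((- a) ^ α B A * (- a) ^ α A E) * (- c) ^ β B * ((- e) ^ γ B A * (- e) ^ γ A E) *
       (b ^ α (C ∪ A) E * (d ^ β A * d ^ β/ A C) * f ^ γ (C ∪ A) E))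
        ≈⟨ *-cong (sign-∣C∣ A⊆E C⊆)
             (*-cong
               (*-cong
                 (*-congʳ (merge (- a) (α B A) (α A E) (α-telescope B⊆A A⊆E id)))
                 (merge (- e) (γ B A) (γ A E) (γ-telescope B⊆A A⊆E id)))
               (*-congʳ (*-congˡ (merge d (β A) (β/ A C) (β-∪ A⊆E C⊆))))) ⟩
      sign ∣ C ∣ * h B (C ∪ A) ∎
      where
      open Solver using (_⊕_; _⊜_)
      merge : ∀ x i j {l} → l ≡ i ℕ.+ j → x ^ i * x ^ j ≈ x ^ l
      merge x i j ≡.refl = sym (^-homo-* x i j)

    𝔗-convolution :
      𝔗 P (1# - a * b) (1# - c * d) (- (e * f)) ≈
        ∑⊆ E (λ A A⊆E →
          a ^ (rank′ ∸ rk′ A) *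
          d ^ (∣ A ∣ ∸ rk A) *
          e ^ ((rank ∸ rk A) ∸ (rank′ ∸ rk′ A)) *
          𝔗 (P ∣[ A , A⊆E ]) (1# - a) (1# - c) (- e) *
          𝔗 (P /[ A , A⊆E ]) (1# - b) (1# - d) (- f))
    𝔗-convolution = begin
      𝔗 P (1# - a * b) (1# - c * d) (- (e * f))
        ≈⟨ ∑⊆-cong E (λ A _ → diagonal A) ⟩
      ∑⊆ E (λ A _ → h A A)
        ≈⟨ ∑₃-alternating E h ⟨
      ∑₃ E (λ A B C → sign ∣ C ∣ * h B (C ∪ A))
        -- Unfolding `𝔗` on the two minors turns the goal into the left side of `expand`, so the
        -- endpoint is left to unification.
        ≈⟨ ∑⊆-cong E (λ A A⊆E → expand A A⊆E) ⟨
      _ ∎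
      where
      expand : ∀ A (A⊆E : A ⊆ E) →
        a ^ α A E * d ^ β A * e ^ γ A E *
        ∑⊆ A (λ B _ → restrictTerm A B) *
        ∑⊆ (E ─ A) (λ C _ → contractTerm ((E ─ A) ∪ A) A C)
          ≈ ∑⊆ A λ B _ → ∑⊆ (E ─ A) λ C _ → sign ∣ C ∣ * h B (C ∪ A)
      expand A A⊆E = begin
        -- The prefactor moves into the sum over `B`, then the whole contraction sum does, and
        -- finally each `B`-term moves into the sum over `C`.
        _ ≈⟨ *-congʳ (*-∑⊆ A _ _) ⟩
        _ ≈⟨ ∑⊆-* A _ _ ⟩
        _ ≈⟨ ∑⊆-cong A (λ B B⊆A → trans (*-∑⊆ (E ─ A) _ _)
               (∑⊆-cong (E ─ A) λ C C⊆ → term-≈ A⊆E B⊆A C⊆)) ⟩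
        _ ∎

proposition6p17 :
    ∀ {k ℓ : Level} (K : CommutativeRing k ℓ) {n : ℕ} {E : Subset n} (P : MatroidPerspective E) →
    let open Polynomial K 6
        open CommutativeRing polynomialRing
        open LasVergnas polynomialRing
        open MatroidPerspective P
        a = var 0F
        b = var 1F
        c = var 2F
        d = var 3F
        e = var 4F
        f = var 5F
    in
      𝔗 P (1# - a * b) (1# - c * d) (- (e * f)) ≈
        ∑⊆ E (λ A A⊆E →
          a ^ (rank′ ∸ rk′ A) *
          d ^ (∣ A ∣ ∸ rk A) *
          e ^ ((rank ∸ rk A) ∸ (rank′ ∸ rk′ A)) *
          𝔗 (P ∣[ A , A⊆E ]) (1# - a) (1# - c) (- e) *
          𝔗 (P /[ A , A⊆E ]) (1# - b) (1# - d) (- f))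
proposition6p17 K P =
  -- The identity holds for any six elements of any commutative ring, in particular for the six
  -- variables.
  𝔗-convolution polynomialRing P (var 0F) (var 1F) (var 2F) (var 3F) (var 4F) (var 5F)
  where open Polynomial K 6
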